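{- Let $K$ and $L$ be finite simple graphs sharing exactly one vertex $v$ and otherwise disjoint, and let $G=K\vee_v L$ be their wedge at $v$. Then $$\operatorname{arb}(G)=\max\{\operatorname{arb}(K),\operatorname{arb}(L)\},$$ where $\operatorname{arb}$ denotes the reduced arboricity.
   Context: All graphs are finite and simple. A forest is a graph containing no cycles. Reduced arboricity: for a graph $G$ with $E(G)\neq\varnothing$, let $k$ be the minimum number of forests whose edge sets partition $E(G)$, and set $\operatorname{arb}(G)=k-1$ (so it is one less than the classical arboricity). If $E(G)=\varnothing$, set $\operatorname{arb}(G)=0$. Wedge: if $K$ and $L$ are graphs sharing exactly one vertex $v$ and otherwise disjoint, then $K\vee_v L$ is their union, i.e. the graph with vertex set $V(K)\cup V(L)$ and edge set $E(K)\cup E(L)$ (the two copies of $v$ being identified). -}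

module Defs where

open import Level using (0ℓ)
open import Data.Bool.Base using (Bool; true; false; T)
open import Data.Bool.Properties using (T?)
open import Data.Empty using (⊥-elim)
open import Data.Fin.Base using (Fin; zero; suc)
open import Data.Fin.Properties using (_≟_; any?; all?; injective⇒≤; ≤-total; ≤-antisym; _≤?_)
open import Data.Fin.Subset using (Subset; ⁅_⁆; _∩_; _∪_; _∈_)
open import Data.Fin.Subset.Properties using (x∈p∪q⁺)
open import Data.List.Base using (List; []; _∷_; _∷ʳ_; length; lookup)
open import Data.List.Membership.Propositional.Properties using (∈-lookup)
open import Data.List.Relation.Unary.All as All using (All; []; _∷_)
open import Data.List.Relation.Unary.AllPairs using ([]; _∷_)
open import Data.List.Relation.Unary.Linked using (Linked; []; [-]; _∷_; linked?)
open import Data.List.Relation.Unary.Unique.Propositional using (Unique)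
open import Data.List.Relation.Unary.Unique.DecPropositional using (unique?)
open import Data.Nat.Base using (ℕ; zero; suc; _≤_; z≤n; s≤s; _∸_)
import Data.Nat.Properties as ℕ
open import Data.Product using (∃; ∃!; ∃₂; _×_; _,_; proj₁; proj₂; map₂)
open import Data.Sum.Base as Sum using (_⊎_; inj₁; inj₂)
open import Data.Vec.Base as Vec using (Vec; []; _∷_; tabulate)
open import Data.Vec.Properties using (lookup∘tabulate)
open import Relation.Binary.Core using (Rel; _⇒_)
open import Relation.Binary.Definitions using (Decidable; Symmetric)
open import Relation.Binary.PropositionalEquality
  using (_≡_; refl; sym; trans; cong; subst)
open import Relation.Nullary using (¬_; Dec; yes; no; does; contradiction)
open import Relation.Nullary.Decidable
  using (map′; _×-dec_; _⊎-dec_; _→-dec_; ¬?)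
open import Relation.Unary using (Pred) renaming (Decidable to Decidable₁)

-- Vertices are drawn from a common ambient set Fin n, which need not be
-- exhausted by any one graph, so that two graphs can literally share
-- some of their vertices.

record Graph (n : ℕ) : Set₁ where
  infix 4 _~_ _~?_
  field
    V      : Subset n
    _~_    : Rel (Fin n) 0ℓ
    _~?_   : Decidable _~_
    ~-sym  : Symmetric _~_
    ~-irr  : ∀ {x} → ¬ x ~ x
    ~-dom  : ∀ {x y} → x ~ y → x ∈ V

open Graph using (V)

Adj : ∀ {n} → Graph n → Rel (Fin n) 0ℓ
Adj = Graph._~_

HasEdge : ∀ {n} → Graph n → Set
HasEdge G = ∃₂ λ x y → Adj G x y

_∪ᴳ_ : ∀ {n} → Graph n → Graph n → Graph n
K ∪ᴳ L = record
  { V      = V K ∪ V L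
  ; _~_    = λ x y → (x K.~ y) ⊎ (x L.~ y)
  ; _~?_   = λ x y → (x K.~? y) ⊎-dec (x L.~? y)
  ; ~-sym  = Sum.map K.~-sym L.~-sym
  ; ~-irr  = Sum.[ K.~-irr , L.~-irr ]
  ; ~-dom  = λ e → x∈p∪q⁺ (Sum.map K.~-dom L.~-dom e)
  }
  where
  module K = Graph K
  module L = Graph L

ShareOnly : ∀ {n} → Graph n → Graph n → Fin n → Set
ShareOnly K L v = V K ∩ V L ≡ ⁅ v ⁆

wedge : ∀ {n} (K L : Graph n) (v : Fin n) → ShareOnly K L v → Graph n
wedge K L _ _ = K ∪ᴳ L

-- The cycle runs through the distinct vertices x , xs in order and back
-- to x.

record IsCycle {n} (G : Graph n) (x : Fin n) (xs : List (Fin n)) : Set where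
  constructor cycle
  field
    long     : 2 ≤ length xs
    distinct : Unique (x ∷ xs)
    closed   : Linked (Adj G) (x ∷ xs ∷ʳ x)

IsForest : ∀ {n} → Graph n → Set
IsForest G = ∀ x xs → ¬ IsCycle G x xs

-- Edgeless forests are allowed; they cannot occur when k is minimal.

record IsForestPartition {n k} (G : Graph n) (F : Fin k → Graph n) : Set where
  field
    forests  : ∀ i → IsForest (F i)
    subedges : ∀ i {x y} → Adj (F i) x y → Adj G x y
    covers   : ∀ {x y} → Adj G x y → ∃! _≡_ λ i → Adj (F i) x y

open IsForestPartition

PartitionsInto : ∀ {n} → Graph n → ℕ → Set₁
PartitionsInto {n} G k = ∃ λ (F : Fin k → Graph n) → IsForestPartition G F

IsLeast : ∀ {ℓ} → Pred ℕ ℓ → Pred ℕ ℓ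
IsLeast P k = P k × (∀ j → P j → k ≤ j)

private
  lookup-injective : ∀ {n} {xs : List (Fin n)} → Unique xs →
                     ∀ {i j} → lookup xs i ≡ lookup xs j → i ≡ j
  lookup-injective (_ ∷ _)  {zero}  {zero}  _  = refl
  lookup-injective {xs = _ ∷ xs} (p ∷ _)  {zero}  {suc j} eq =
    contradiction eq (All.lookup p (∈-lookup {xs = xs} j))
  lookup-injective {xs = _ ∷ xs} (p ∷ _)  {suc i} {zero}  eq =
    contradiction (sym eq) (All.lookup p (∈-lookup {xs = xs} i))
  lookup-injective (_ ∷ u)  {suc i} {suc j} eq =
    cong suc (lookup-injective u eq)

  unique⇒length≤ : ∀ {n} {xs : List (Fin n)} → Unique xs → length xs ≤ n
  unique⇒length≤ u = injective⇒≤ (lookup-injective u)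

  anyList? : ∀ {n} m {P : Pred (List (Fin n)) 0ℓ} → Decidable₁ P →
             Dec (∃ λ xs → length xs ≤ m × P xs)
  anyList? zero P? = map′ (λ p → [] , z≤n , p) (λ { ([] , _ , p) → p }) (P? [])
  anyList? (suc m) P? = map′
    (λ { (inj₁ p) → [] , z≤n , p
       ; (inj₂ (x , xs , le , p)) → x ∷ xs , s≤s le , p })
    (λ { ([] , _ , p) → inj₁ p
       ; (x ∷ xs , s≤s le , p) → inj₂ (x , xs , le , p) })
    (P? [] ⊎-dec any? λ x → anyList? m λ xs → P? (x ∷ xs))

isCycle? : ∀ {n} (G : Graph n) x xs → Dec (IsCycle G x xs)
isCycle? G x xs = map′
  (λ (a , b , c) → cycle a b c)
  (λ (cycle a b c) → a , b , c)
  ((2 ℕ.≤? length xs) ×-dec unique? _≟_ (x ∷ xs)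
    ×-dec linked? (Graph._~?_ G) (x ∷ xs ∷ʳ x))

isForest? : ∀ {n} (G : Graph n) → Dec (IsForest G)
isForest? {n} G = map′
  (λ none x xs c → none (x , xs ,
     ℕ.≤-trans (ℕ.n≤1+n _) (unique⇒length≤ (IsCycle.distinct c)) , c))
  (λ forest (x , xs , _ , c) → forest x xs c)
  (¬? (any? λ x → anyList? n (isCycle? G x)))

private
  isForestPartition? : ∀ {n k} (G : Graph n) (F : Fin k → Graph n) →
                       Dec (IsForestPartition G F)
  isForestPartition? G F = map′
    (λ (f , s , c) → record
      { forests = f ; subedges = λ i → s i _ _ ; covers = λ e →
          map₂ (λ (p , u) → p , λ q → u _ q) (c _ _ e) })
    (λ P → forests P , (λ i _ _ → subedges P i) , (λ _ _ e →
          map₂ (λ (p , u) → p , λ _ q → u q) (covers P e)))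
    ( all? (λ i → isForest? (F i))
    ×-dec all? (λ i → all? λ x → all? λ y → (F i ~? x) y →-dec (G ~? x) y)
    ×-dec all? (λ x → all? λ y → (G ~? x) y →-dec
            any? λ i → (F i ~? x) y ×-dec all? λ j → (F j ~? x) y →-dec (i ≟ j)))
    where _~?_ = Graph._~?_

  Linked-map : ∀ {n} {R S : Rel (Fin n) 0ℓ} → R ⇒ S →
               ∀ {xs} → Linked R xs → Linked S xs
  Linked-map f []       = []
  Linked-map f [-]      = [-]
  Linked-map f (r ∷ rs) = f r ∷ Linked-map f rs

  transport : ∀ {n k} {G : Graph n} {F F′ : Fin k → Graph n} →
              (∀ i → Adj (F i) ⇒ Adj (F′ i)) → (∀ i → Adj (F′ i) ⇒ Adj (F i)) →
              IsForestPartition G F → IsForestPartition G F′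
  transport to from P = record
    { forests  = λ i x xs (cycle l d c) →
        forests P i x xs (cycle l d (Linked-map (from i) c))
    ; subedges = λ i e → subedges P i (from i e)
    ; covers   = λ e →
        map₂ (λ {i} (p , u) → to i p , λ {j} q → u (from j q)) (covers P e)
    }

  Searchable : Set → Set₁
  Searchable A = ∀ {P : Pred A 0ℓ} → Decidable₁ P → Dec (∃ P)

  Bool-searchable : Searchable Bool
  Bool-searchable P? = map′
    (λ { (inj₁ p) → true , p ; (inj₂ p) → false , p })
    (λ { (true , p) → inj₁ p ; (false , p) → inj₂ p })
    (P? true ⊎-dec P? false)

  Vec-searchable : ∀ {A} → Searchable A → ∀ n → Searchable (Vec A n)
  Vec-searchable s zero P? =
    map′ (λ p → [] , p) (λ { ([] , p) → p }) (P? [])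
  Vec-searchable s (suc n) P? = map′
    (λ (x , xs , p) → x ∷ xs , p)
    (λ { (x ∷ xs , p) → x , xs , p })
    (s λ x → Vec-searchable s n λ xs → P? (x ∷ xs))

  Matrix : ℕ → Set
  Matrix n = Vec (Vec Bool n) n

  Entry : ∀ {n} → Matrix n → Rel (Fin n) 0ℓ
  Entry M x y = T (Vec.lookup (Vec.lookup M x) y)

  restrict : ∀ {n} → Graph n → Matrix n → Graph n
  restrict G M = record
    { V      = V G
    ; _~_    = λ x y → (x ~ y) × Entry M x y × Entry M y x
    ; _~?_   = λ x y → (x ~? y) ×-dec T? _ ×-dec T? _
    ; ~-sym  = λ (e , p , q) → ~-sym e , q , p
    ; ~-irr  = λ (e , _) → ~-irr e
    ; ~-dom  = λ (e , _) → ~-dom e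
    } where open Graph G hiding (V)

  matrix : ∀ {n} → Graph n → Matrix n
  matrix G = tabulate λ x → tabulate λ y → does (Graph._~?_ G x y)

  T-does : ∀ {P : Set} (P? : Dec P) → T (does P?) → P
  T-does (yes p) _ = p

  does-T : ∀ {P : Set} (P? : Dec P) → P → T (does P?)
  does-T (yes _) _ = _
  does-T (no ¬p) p = ¬p p

  matrix-entry : ∀ {n} (G : Graph n) x y →
    Vec.lookup (Vec.lookup (matrix G) x) y ≡ does (Graph._~?_ G x y)
  matrix-entry G x y = trans
    (cong (λ r → Vec.lookup r y) (lookup∘tabulate _ x)) (lookup∘tabulate _ y)

  entry⁺ : ∀ {n} (G : Graph n) {x y} → Adj G x y → Entry (matrix G) x y
  entry⁺ G {x} {y} e =
    subst T (sym (matrix-entry G x y)) (does-T (Graph._~?_ G x y) e)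

  entry⁻ : ∀ {n} (G : Graph n) {x y} → Entry (matrix G) x y → Adj G x y
  entry⁻ G {x} {y} t =
    T-does (Graph._~?_ G x y) (subst T (matrix-entry G x y) t)

partitionsInto? : ∀ {n} (G : Graph n) → Decidable₁ (PartitionsInto G)
partitionsInto? {n} G k = map′
  (λ (Ms , P) → family Ms , P)
  (λ (F , P) → tabulate (λ i → matrix (F i)) , transport
    (λ i e → subedges P i e , coded F i (entry⁺ (F i) e)
           , coded F i (entry⁺ (F i) (Graph.~-sym (F i) e)))
    (λ i (_ , t , _) → entry⁻ (F i) (uncoded F i t))
    P)
  (Vec-searchable (Vec-searchable (Vec-searchable Bool-searchable n) n) k
    λ Ms → isForestPartition? G (family Ms))
  where
  family : Vec (Matrix n) k → Fin k → Graph n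
  family Ms i = restrict G (Vec.lookup Ms i)

  module _ (F : Fin k → Graph n) (i : Fin k) {x y : Fin n} where
    coded : Entry (matrix (F i)) x y →
            Entry (Vec.lookup (tabulate (λ j → matrix (F j))) i) x y
    coded = subst (λ M → Entry M x y) (sym (lookup∘tabulate _ i))

    uncoded : Entry (Vec.lookup (tabulate (λ j → matrix (F j))) i) x y →
              Entry (matrix (F i)) x y
    uncoded = subst (λ M → Entry M x y) (lookup∘tabulate _ i)

private
  lesser : ∀ {n} → Fin n → Fin n → Fin n
  lesser x y with x ≤? y
  ... | yes _ = x
  ... | no  _ = y

  lesser-sel : ∀ {n} (x y : Fin n) → lesser x y ≡ x ⊎ lesser x y ≡ y
  lesser-sel x y with x ≤? y
  ... | yes _ = inj₁ refl
  ... | no  _ = inj₂ refl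

  lesser-comm : ∀ {n} (x y : Fin n) → lesser x y ≡ lesser y x
  lesser-comm x y with x ≤? y | y ≤? x
  ... | yes p | yes q = ≤-antisym p q
  ... | yes _ | no  _ = refl
  ... | no  _ | yes _ = refl
  ... | no ¬p | no ¬q = ⊥-elim (Sum.[ ¬p , ¬q ] (≤-total x y))

  star : ∀ {n} → Graph n → Fin n → Graph n
  star G i = record
    { V      = V G
    ; _~_    = λ x y → (x ~ y) × lesser x y ≡ i
    ; _~?_   = λ x y → (x ~? y) ×-dec (lesser x y ≟ i)
    ; ~-sym  = λ {x} {y} (e , p) → ~-sym e , trans (lesser-comm y x) p
    ; ~-irr  = λ (e , _) → ~-irr e
    ; ~-dom  = λ (e , _) → ~-dom e
    } where open Graph G hiding (V)

  star-end : ∀ {n} (G : Graph n) i {x y} → Adj (star G i) x y → x ≡ i ⊎ y ≡ i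
  star-end G i {x} {y} (_ , p) =
    Sum.map (λ q → trans (sym q) p) (λ q → trans (sym q) p) (lesser-sel x y)

  final : ∀ {n} {R : Rel (Fin n) 0ℓ} {P : Pred (Fin n) 0ℓ} {z x} zs →
          All P (z ∷ zs) → Linked R (z ∷ zs ∷ʳ x) → ∃ λ w → P w × R w x
  final []       (p ∷ _)  (r ∷ _)  = _ , p , r
  final (_ ∷ zs) (_ ∷ ps) (_ ∷ rs) = final zs ps rs

  star-forest : ∀ {n} (G : Graph n) i → IsForest (star G i)
  star-forest G i x (y ∷ z ∷ zs)
    (cycle _ ((x≢y ∷ x≢z ∷ _) ∷ (y≢s ∷ _)) (xy ∷ yz ∷ rest))
    with final zs y≢s rest
  ... | w , y≢w , wx with star-end G i xy | star-end G i yz | star-end G i wx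
  ... | inj₁ p | inj₁ q | _      = x≢y (trans p (sym q))
  ... | inj₁ p | inj₂ q | _      = x≢z (trans p (sym q))
  ... | inj₂ p | _      | inj₁ q = y≢w (trans p (sym q))
  ... | inj₂ p | _      | inj₂ q = x≢y (trans q (sym p))
  star-forest G i x []       (cycle () _ _)
  star-forest G i x (_ ∷ []) (cycle (s≤s ()) _ _)

-- The i-th forest is the star of edges whose smaller endpoint is i.

partitionsInto-n : ∀ {n} (G : Graph n) → PartitionsInto G n
partitionsInto-n G = star G , record
  { forests  = star-forest G
  ; subedges = λ _ → proj₁
  ; covers   = λ e → _ , (e , refl) , proj₂
  }

private
  least : ∀ {ℓ} {P : Pred ℕ ℓ} → Decidable₁ P → ∀ k → P k → ∃ (IsLeast P)
  least P? zero p = zero , p , λ _ _ → z≤n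
  least {P = P} P? (suc k) p with P? zero
  ... | yes p₀ = zero , p₀ , λ _ _ → z≤n
  ... | no ¬p₀ with least (λ j → P? (suc j)) k p
  ...   | m , pm , min = suc m , pm , λ where
            zero    p₀ → contradiction p₀ ¬p₀
            (suc j) pj → s≤s (min j pj)

minForests : ∀ {n} (G : Graph n) → ∃ (IsLeast (PartitionsInto G))
minForests {n} G = least (partitionsInto? G) n (partitionsInto-n G)

hasEdge? : ∀ {n} (G : Graph n) → Dec (HasEdge G)
hasEdge? G = any? λ x → any? λ y → Graph._~?_ G x y

arb : ∀ {n} → Graph n → ℕ
arb G with hasEdge? G
... | yes _ = proj₁ (minForests G) ∸ 1
... | no  _ = 0

{-# OPTIONS --safe #-}
module Submission where

open import Data.Empty using (⊥; ⊥-elim)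
open import Data.Fin.Base using (Fin; zero; suc)
open import Data.Fin.Properties using (_≟_)
open import Data.Fin.Subset using (_∈_)
open import Data.Fin.Subset.Properties using (x∈p∩q⁺; x∈⁅y⁆⇒x≡y)
open import Data.List.Base using ([]; _∷_; _∷ʳ_)
open import Data.List.Relation.Unary.All using (All; []; _∷_)
open import Data.List.Relation.Unary.AllPairs using ([]; _∷_)
open import Data.List.Relation.Unary.Linked as Linked using (Linked; [-]; _∷_)
open import Data.List.Relation.Unary.Unique.Propositional using (Unique)
open import Data.Nat.Base using (ℕ; suc; _≤_; _∸_; _⊔_; _≤′_; ≤′-refl; ≤′-step)
open import Data.Nat.Properties
  using (≤-antisym; ≤⇒≤′; ⊔-lub; m≤m⊔n; m≤n⊔m; n≤0⇒n≡0; ∸-distribʳ-⊔)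
open import Data.Product using (∃; _×_; _,_; proj₁; proj₂; map₂)
open import Data.Sum.Base using (inj₁; inj₂; [_,_]; swap)
open import Function.Base using (_∘_; case_of_)
open import Relation.Binary.Core using (_⇒_)
open import Relation.Binary.PropositionalEquality
  using (_≡_; _≢_; refl; sym; trans; cong; subst)
open import Relation.Nullary using (¬_; yes; no; contradiction)
open import Relation.Nullary.Decidable using (_×-dec_)
open import Defs

-- Cutting forests down to a subgraph shows that both minimal numbers of
-- forests are at most that of the wedge.  Conversely, the i-th forests of
-- K and of L may be merged: a cycle passes through v at most once, and two
-- consecutive edges of the cycle can lie on different sides only at v, so
-- the cycle lies on one side.

private
  variable
    n k m : ℕ

-- Phrased by edges because a forest partition leaves the vertex sets of its forests unconstrained;
-- in this form the condition passes from `K` and `L` to their `i`-th forests.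
MeetOnlyAt : Fin n → Graph n → Graph n → Set
MeetOnlyAt v A B = ∀ {x y z} → Adj A x y → Adj B x z → x ≡ v

module _ {v : Fin n} {A B : Graph n} (meet : MeetOnlyAt v A B) where
  private
    module A = Graph A
    module B = Graph B

  MeetOnlyAt-sym : MeetOnlyAt v B A
  MeetOnlyAt-sym b a = meet a b

  -- A common edge would have both ends equal to `v`, hence be a loop.
  meeting-edge-disjoint : ∀ {x y} → Adj A x y → ¬ Adj B x y
  meeting-edge-disjoint a b =
    A.~-irr (subst (Adj A _) (trans (meet (A.~-sym a) (B.~-sym b)) (sym (meet a b))) a)

  edge-stays-left : ∀ {x y z} → x ≢ v → Adj A x y → Adj (A ∪ᴳ B) x z → Adj A x z
  edge-stays-left x≢v a (inj₁ e) = e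
  edge-stays-left x≢v a (inj₂ e) = contradiction (meet a e) x≢v

  -- Induction from the far end: the last edge enters `x`, which is not `v` and already carries a
  -- left edge; each earlier edge enters a vertex other than `v` that a left edge leaves. On the
  -- walk only `z` may be `v`.
  walk-into-left : ∀ {x w} z zs → x ≢ v → Adj A x w → All (v ≢_) zs →
                   Linked (Adj (A ∪ᴳ B)) (z ∷ zs ∷ʳ x) → Linked (Adj A) (z ∷ zs ∷ʳ x)
  walk-into-left z [] x≢v a [] (e ∷ [-]) =
    A.~-sym (edge-stays-left x≢v a (Graph.~-sym (A ∪ᴳ B) e)) ∷ [-]
  walk-into-left z (y ∷ ys) x≢v a (v≢y ∷ v∉ys) (e ∷ es)
    with walk-into-left y ys x≢v a v∉ys es
  ... | es′ = A.~-sym (edge-stays-left (v≢y ∘ sym) (proj₂ (first-edge ys es′))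
                                       (Graph.~-sym (A ∪ᴳ B) e)) ∷ es′
    where
    first-edge : ∀ {x} zs → Linked (Adj A) (y ∷ zs ∷ʳ x) → ∃ (Adj A y)
    first-edge []      (a ∷ _) = _ , a
    first-edge (_ ∷ _) (a ∷ _) = _ , a

  -- Forwards from the left edge the walk stays left until it meets v; the
  -- part after v is then read backwards from x.
  walk-stays-left : ∀ {x w z} y ys → Adj A x w → (x ≡ v → All (v ≢_) (y ∷ ys)) →
                    Unique (y ∷ ys) → Adj A z y →
                    Linked (Adj (A ∪ᴳ B)) (y ∷ ys ∷ʳ x) → Linked (Adj A) (y ∷ ys ∷ʳ x)
  walk-stays-left y ys xw avoid (y∉ys ∷ uniq) zy es with y ≟ v
  walk-stays-left y ys xw avoid (y∉ys ∷ uniq) zy es | yes refl =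
    walk-into-left y ys (λ x≡v → case avoid x≡v of λ { (v≢v ∷ _) → v≢v refl }) xw y∉ys es
  walk-stays-left y [] xw avoid _ zy (e ∷ es) | no y≢v =
    edge-stays-left y≢v (A.~-sym zy) e ∷ [-]
  walk-stays-left y (u ∷ us) xw avoid (_ ∷ uniq) zy (e ∷ es) | no y≢v =
    yu ∷ walk-stays-left u us xw (λ x≡v → case avoid x≡v of λ { (_ ∷ r) → r }) uniq yu es
    where
    yu = edge-stays-left y≢v (A.~-sym zy) e

  cycle-stays-left : ∀ {x y ys} → IsCycle (A ∪ᴳ B) x (y ∷ ys) → Adj A x y →
                     IsCycle A x (y ∷ ys)
  cycle-stays-left {y = y} {ys} (cycle long (x∉ ∷ uniq) (_ ∷ es)) xy =
    cycle long (x∉ ∷ uniq)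
      -- `xy` serves twice: as the left edge at `x` for reading backwards and as the left edge into
      -- `y` for reading forwards. If `x` is `v`, distinctness keeps `v` off the rest of the cycle.
      (xy ∷ walk-stays-left y ys xy (λ { refl → x∉ }) uniq xy es)

subgraph-forest : {G H : Graph n} → Adj H ⇒ Adj G → IsForest G → IsForest H
subgraph-forest H⊆G forest x xs (cycle l d c) = forest x xs (cycle l d (Linked.map H⊆G c))

∪ᴳ-forest : ∀ {v} {A B : Graph n} → MeetOnlyAt v A B →
            IsForest A → IsForest B → IsForest (A ∪ᴳ B)
∪ᴳ-forest meet fA fB x [] (cycle () _ _)
∪ᴳ-forest {A = A} {B} meet fA fB x (y ∷ ys) c@(cycle _ _ (inj₁ a ∷ _)) =
  fA x (y ∷ ys) (cycle-stays-left {A = A} {B} meet c a)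
∪ᴳ-forest {A = A} {B} meet fA fB x (y ∷ ys) (cycle l d es@(inj₂ b ∷ _)) =
  fB x (y ∷ ys)
    (cycle-stays-left {A = B} {A} (MeetOnlyAt-sym {A = A} {B} meet)
      (cycle l d (Linked.map swap es)) b)

_∩ᴳ_ : Graph n → Graph n → Graph n
G ∩ᴳ H = record
  { V      = G.V
  ; _~_    = λ x y → (x G.~ y) × (x H.~ y)
  ; _~?_   = λ x y → (x G.~? y) ×-dec (x H.~? y)
  ; ~-sym  = λ (g , h) → G.~-sym g , H.~-sym h
  ; ~-irr  = G.~-irr ∘ proj₁
  ; ~-dom  = G.~-dom ∘ proj₁
  }
  where
  module G = Graph G
  module H = Graph H

edgeless : Graph n → Graph n
edgeless G = record
  { V      = Graph.V G
  ; _~_    = λ _ _ → ⊥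
  ; _~?_   = λ _ _ → no λ ()
  ; ~-sym  = λ ()
  ; ~-irr  = λ ()
  ; ~-dom  = λ ()
  }

edgeless-forest : (G : Graph n) → IsForest (edgeless G)
edgeless-forest G x []       (cycle () _ _)
edgeless-forest G x (_ ∷ _) (cycle _ _ (() ∷ _))

-- Intersecting each forest with `H` creates no cycle and keeps the class of an edge unique; classes
-- that lose all their edges are still allowed.
subgraph-partition : {G H : Graph n} → Adj H ⇒ Adj G → PartitionsInto G k → PartitionsInto H k
subgraph-partition {H = H} H⊆G (F , P) = (λ i → F i ∩ᴳ H) , record
  { forests  = λ i → subgraph-forest {G = F i} {F i ∩ᴳ H} proj₁ (P.forests i)
  ; subedges = λ _ → proj₂
  ; covers   = λ h → map₂ (λ (f , u) → (f , h) , u ∘ proj₁) (P.covers (H⊆G h))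
  }
  where
  module P = IsForestPartition P

-- An extra edgeless class is harmless. This lets partitions of `K` and `L` be brought to equal
-- length before they are merged index by index.
pad-partition : (G : Graph n) → PartitionsInto G k → PartitionsInto G (suc k)
pad-partition {n} {k} G (F , P) = F⁺ , record
  { forests  = λ { zero → edgeless-forest G ; (suc i) → P.forests i }
  ; subedges = λ { (suc i) → P.subedges i }
  ; covers   = λ g → case P.covers g of λ (i , f , u) →
      suc i , f , λ { {suc j} f′ → cong suc (u f′) }
  }
  where
  module P = IsForestPartition P
  F⁺ : Fin (suc k) → Graph n
  F⁺ zero    = edgeless G
  F⁺ (suc i) = F i

partition-mono : (G : Graph n) → k ≤′ m → PartitionsInto G k → PartitionsInto G m
partition-mono G ≤′-refl       p = p
partition-mono G (≤′-step k≤m) p = pad-partition G (partition-mono G k≤m p)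

∪ᴳ-partition : ∀ {v} {K L : Graph n} → MeetOnlyAt v K L →
               PartitionsInto K k → PartitionsInto L k → PartitionsInto (K ∪ᴳ L) k
∪ᴳ-partition {K = K} {L} meet (F , P) (F′ , Q) = (λ i → F i ∪ᴳ F′ i) , record
  { forests  = λ i → ∪ᴳ-forest {A = F i} {F′ i}
      (λ f f′ → meet (P.subedges i f) (Q.subedges i f′)) (P.forests i) (Q.forests i)
  ; subedges = λ i → [ inj₁ ∘ P.subedges i , inj₂ ∘ Q.subedges i ]
  -- The class of an edge stays unique: an edge of `K` is not an edge of `L`, so it lies in no
  -- forest of `L`, and conversely.
  ; covers   = λ
      { (inj₁ e) → map₂
          (λ (f , u) → inj₁ f , [ u , (λ f′ → ⊥-elim (disjoint e (Q.subedges _ f′))) ])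
          (P.covers e)
      ; (inj₂ e) → map₂
          (λ (f′ , u) → inj₂ f′ , [ (λ f → ⊥-elim (disjoint (P.subedges _ f) e)) , u ])
          (Q.covers e)
      }
  }
  where
  module P = IsForestPartition P
  module Q = IsForestPartition Q
  disjoint : ∀ {x y} → Adj K x y → ¬ Adj L x y
  disjoint = meeting-edge-disjoint {A = K} {L} meet

ShareOnly⇒MeetOnlyAt : ∀ {v} {K L : Graph n} → ShareOnly K L v → MeetOnlyAt v K L
ShareOnly⇒MeetOnlyAt {v = v} {K} {L} s k l =
  x∈⁅y⁆⇒x≡y v (subst (_ ∈_) s (x∈p∩q⁺ (Graph.~-dom K k , Graph.~-dom L l)))

-- The classical arboricity, before the reduction by one. For it the maximum formula needs no case
-- split on whether edges exist.
arboricity : Graph n → ℕ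
arboricity G = proj₁ (minForests G)

arboricity-partition : (G : Graph n) → PartitionsInto G (arboricity G)
arboricity-partition G = proj₁ (proj₂ (minForests G))

arboricity-min : (G : Graph n) → PartitionsInto G k → arboricity G ≤ k
arboricity-min G = proj₂ (proj₂ (minForests G)) _

arboricity-subgraph : {G H : Graph n} → Adj H ⇒ Adj G → arboricity H ≤ arboricity G
arboricity-subgraph {G = G} {H} H⊆G =
  arboricity-min H (subgraph-partition {G = G} {H} H⊆G (arboricity-partition G))

arboricity-∪ᴳ : ∀ {v} {K L : Graph n} → MeetOnlyAt v K L →
                arboricity (K ∪ᴳ L) ≡ arboricity K ⊔ arboricity L
arboricity-∪ᴳ {K = K} {L} meet = ≤-antisym
  -- Both optimal partitions are padded to the larger of the two sizes.
  (arboricity-min (K ∪ᴳ L) (∪ᴳ-partition {K = K} {L} meet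
    (partition-mono K (≤⇒≤′ (m≤m⊔n _ _)) (arboricity-partition K))
    (partition-mono L (≤⇒≤′ (m≤n⊔m _ _)) (arboricity-partition L))))
  (⊔-lub (arboricity-subgraph {G = K ∪ᴳ L} {K} inj₁)
         (arboricity-subgraph {G = K ∪ᴳ L} {L} inj₂))

-- An edgeless graph is partitioned into no forests at all, and 0 ∸ 1 = 0.
arb≡arboricity∸1 : (G : Graph n) → arb G ≡ arboricity G ∸ 1
arb≡arboricity∸1 G with hasEdge? G
... | yes _ = refl
... | no ¬e = sym (cong (_∸ 1) (n≤0⇒n≡0 (arboricity-min G ((λ ()) , record
  { forests  = λ ()
  ; subedges = λ ()
  ; covers   = λ e → contradiction (_ , _ , e) ¬e
  }))))

theorem17 : ∀ {n : ℕ} (K L : Graph n) (v : Fin n) (s : ShareOnly K L v) →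
    arb (wedge K L v s) ≡ arb K ⊔ arb L
theorem17 K L v s
  rewrite arb≡arboricity∸1 (K ∪ᴳ L) | arb≡arboricity∸1 K | arb≡arboricity∸1 L
        | arboricity-∪ᴳ {K = K} {L} (ShareOnly⇒MeetOnlyAt {K = K} {L} s)
  -- Truncated subtraction of 1 commutes with maxima, including where a side is edgeless and its
  -- count is 0.
  = ∸-distribʳ-⊔ 1 (arboricity K) (arboricity L)
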